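{- Let $f$ be a formula over three variables such that $ABA.BCB.ACA\preceq f\preceq ABA.ABCBA.ACA.ACB.BCA$. Every ternary recurrent infinite word avoiding $f$ is equivalent to $w_3$, $\sigma(w_3)$, or $\sigma^2(w_3)$.
   Context: A formula is a finite set of non-empty words over variables $A,B,C,\dots$ (fragments), written separated by dots. An occurrence of a formula $f$ in a word $w$ is a non-erasing morphism $h$ from variables to non-empty words such that $h(\phi)$ is a factor of $w$ for every fragment $\phi$ of $f$; $w$ avoids $f$ if it has no occurrence. $g\preceq f$ means there is a non-erasing morphism $h$ such that the $h$-image of every fragment of $g$ is a factor of some fragment of $f$. An infinite word is recurrent if each of its finite factors occurs infinitely often; two infinite words are equivalent if they have the same set of finite factors. Let $\Sigma_3=\{0,1,2\}$ and $\sigma$ be the morphism $0\mapsto1,1\mapsto2,2\mapsto0$. Let $b_5$ be the fixed point starting with $0$ of the morphism $0\mapsto 01,\ 1\mapsto 23,\ 2\mapsto 4,\ 3\mapsto 21,\ 4\mapsto 0$, and let $w_3=M_2(b_5)$ where $M_2$ is the morphism $0\mapsto 02,\ 1\mapsto 1,\ 2\mapsto 0,\ 3\mapsto 12,\ 4\mapsto\varepsilon$. -}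

module Defs where

open import Data.Nat using (ℕ; zero; suc; _+_; _≤_)
open import Data.Fin using (Fin; zero; suc)
open import Data.List using (List; []; _∷_; map; concatMap; length; upTo)
open import Data.List.Relation.Unary.All using (All)
open import Data.List.Relation.Unary.Any using (Any)
open import Data.List.Relation.Binary.Infix.Heterogeneous using (Infix)
open import Data.Product using (Σ; ∃; _×_; _,_)
open import Relation.Binary.PropositionalEquality using (_≡_; _≢_)
open import Function.Bundles using (_⇔_)

InfWord : Set → Set
InfWord A = ℕ → A

slice : {A : Set} → InfWord A → ℕ → ℕ → List A
slice x i n = map (λ j → x (i + j)) (upTo n)

FactorOf : {A : Set} → List A → InfWord A → Set
FactorOf u x = ∃ λ i → slice x i (length u) ≡ u

Recurrent : {A : Set} → InfWord A → Set
Recurrent x = ∀ i n N → ∃ λ k → (N ≤ k) × (slice x k n ≡ slice x i n)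

Equivalent : {A : Set} → InfWord A → InfWord A → Set
Equivalent x y = ∀ u → FactorOf u x ⇔ FactorOf u y

image : {A B : Set} → (A → List B) → List A → List B
image h u = concatMap h u

Fragment : ℕ → Set
Fragment n = List (Fin n)

-- a formula is a finite set (given as a list) of fragments
Formula : ℕ → Set
Formula n = List (Fragment n)

NonEmpty : {A : Set} → List A → Set
NonEmpty u = u ≢ []

IsFormula : {n : ℕ} → Formula n → Set
IsFormula f = All NonEmpty f

NonErasing : {n : ℕ} {B : Set} → (Fin n → List B) → Set
NonErasing h = ∀ v → NonEmpty (h v)

IsOccurrence : {n : ℕ} {B : Set} → Formula n → (Fin n → List B) → InfWord B → Set
IsOccurrence f h x = NonErasing h × All (λ φ → FactorOf (image h φ) x) f

Avoids : {n : ℕ} {B : Set} → InfWord B → Formula n → Set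
Avoids {n} {B} x f = (h : Fin n → List B) → IsOccurrence f h x → Data.Empty.⊥
  where import Data.Empty

_⪯_ : {m n : ℕ} → Formula m → Formula n → Set
_⪯_ {m} {n} g f =
  Σ (Fin m → List (Fin n)) λ h →
    NonErasing h × All (λ φ → Any (λ ψ → Infix _≡_ (image h φ) ψ) f) g

vA vB vC : Fin 3
vA = zero
vB = suc zero
vC = suc (suc zero)

lowerF : Formula 3
lowerF = (vA ∷ vB ∷ vA ∷ []) ∷ (vB ∷ vC ∷ vB ∷ []) ∷ (vA ∷ vC ∷ vA ∷ []) ∷ []

upperF : Formula 3
upperF = (vA ∷ vB ∷ vA ∷ [])
       ∷ (vA ∷ vB ∷ vC ∷ vB ∷ vA ∷ [])
       ∷ (vA ∷ vC ∷ vA ∷ [])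
       ∷ (vA ∷ vC ∷ vB ∷ [])
       ∷ (vB ∷ vC ∷ vA ∷ [])
       ∷ []

l0 l1 l2 l3 l4 : Fin 5
l0 = zero
l1 = suc zero
l2 = suc (suc zero)
l3 = suc (suc (suc zero))
l4 = suc (suc (suc (suc zero)))

t0 t1 t2 : Fin 3
t0 = zero
t1 = suc zero
t2 = suc (suc zero)

μ5 : Fin 5 → List (Fin 5)
μ5 zero = l0 ∷ l1 ∷ []
μ5 (suc zero) = l2 ∷ l3 ∷ []
μ5 (suc (suc zero)) = l4 ∷ []
μ5 (suc (suc (suc zero))) = l2 ∷ l1 ∷ []
μ5 (suc (suc (suc (suc zero)))) = l0 ∷ []

M2 : Fin 5 → List (Fin 3)
M2 zero = t0 ∷ t2 ∷ []
M2 (suc zero) = t1 ∷ []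
M2 (suc (suc zero)) = t0 ∷ []
M2 (suc (suc (suc zero))) = t1 ∷ t2 ∷ []
M2 (suc (suc (suc (suc zero)))) = []

iter : ℕ → List (Fin 5)
iter zero = l0 ∷ []
iter (suc k) = image μ5 (iter k)

nth : {A : Set} → A → List A → ℕ → A
nth d [] _ = d
nth d (a ∷ u) zero = a
nth d (a ∷ u) (suc i) = nth d u i

-- b5 = lim μ5^k(0); μ5^(i+1)(0) has length ≥ i+2 and is a prefix of b5
b5 : InfWord (Fin 5)
b5 i = nth l0 (iter (suc i)) i

-- w3 = M2(b5); M2(μ5^(i+2)(0)) is a prefix of w3 of length ≥ i+1
-- (since M2(μ5²(a)) ≠ ε for every letter a)
w3 : InfWord (Fin 3)
w3 i = nth t0 (image M2 (iter (suc (suc i)))) i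

σ : Fin 3 → Fin 3
σ zero = t1
σ (suc zero) = t2
σ (suc (suc zero)) = t0

mapW : {A B : Set} → (A → B) → InfWord A → InfWord B
mapW g x i = g (x i)

{-# OPTIONS --safe #-}

-- As f ⪯ upperF, x avoids ABA.ABCBA.ACA.ACB.BCA.  Then x is square-free, since a
-- square uu would return as w = uuduu and w as wzw, which is an occurrence.  Draw an arc a → b
-- when aba is a factor of x.  In square-free words bcb only extends to abcba, and every word
-- abc is unavoidable, so no three arcs form a transitive triangle; as a cyclic triangle forces a
-- further arc, one of the pairs {aba, bab} is missing, and up to σ it is {121, 212}.
--
-- A square-free ternary word without 121 and 212 is M2(y) with y a walk in the graph of
-- two-letter factors of b5, and square-freeness makes y = μ5(y') with y' again such a walk,
-- indefinitely.  So every factor of x lies in some M2(μ5^k(ab)) with ab a factor of b5, and every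
-- M2(μ5^k(0)) is a factor of x.

module Submission where

open import Defs
open import Data.Bool using (Bool; false; _∨_; T)
open import Data.Bool.ListAction using (all)
open import Data.Bool.Properties using (T-∨)
open import Data.Empty using (⊥; ⊥-elim)
open import Data.Fin using (Fin; zero; suc)
open import Data.Fin.Properties using (_≟_; all?)
open import Data.List using (List; []; _∷_; _++_; map; length; allFin; applyUpTo; upTo)
open import Data.List.Membership.Propositional using (_∈_)
open import Data.List.Membership.Propositional.Properties using (∈-allFin)
open import Data.List.Properties using (length-++; length-++-comm; map-∘; map-cong; map-id; map-++; map-applyUpTo; ++-assoc; ++-identityʳ; ++-conicalˡ; ++-conicalʳ; ++-monoid; concatMap-++; ∷-injective)
open import Data.List.Relation.Binary.Infix.Heterogeneous using (Infix; here; there)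
open import Data.List.Relation.Binary.Prefix.Heterogeneous using (Prefix; []; _∷_)
open import Data.List.Relation.Binary.Prefix.Heterogeneous.Properties using (prefix?)
open import Data.List.Relation.Unary.All as All using (All; []; _∷_)
open import Data.List.Relation.Unary.All.Properties using (all⁺)
open import Data.List.Relation.Unary.Any as Any using (Any; here; there; any?)
open import Data.List.Relation.Unary.Any.Properties using (++⁻)
open import Data.List.Relation.Unary.Linked using (Linked; []; [-]; _∷_)
open import Data.Nat using (ℕ; zero; suc; _+_; _∸_; _*_; _^_; _≤_; _<_; _≤?_; z≤n; s≤s)
open import Data.Nat.Properties using (≤-trans; ≤-reflexive; <⇒≤; ≰⇒>; <-irrefl; n≤1+n; m≤m+n; m≤n+m; +-suc; +-identityʳ; +-comm; +-mono-≤; m+[n∸m]≡n; m∸n+n≡m; *-monoˡ-≤; *-assoc)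
open import Data.Product using (∃; ∃₂; _×_; _,_; proj₁; proj₂)
open import Data.Product.Properties using (≡-dec)
open import Data.Sum using (_⊎_; inj₁; inj₂)
open import Data.Unit using (tt)
open import Function using (_∘_; id)
open import Function.Bundles using (Equivalence; mk⇔)
open import Relation.Binary.PropositionalEquality using (_≡_; _≢_; refl; sym; ≢-sym; trans; cong; cong₂; subst; module ≡-Reasoning)
open import Relation.Nullary using (¬_; Dec; yes; no)
open import Relation.Nullary.Decidable using (isYes; toWitness; ¬?; _×-dec_; _⊎-dec_; _→-dec_)

-- Factors of infinite words

-- An inductive form of `slice`: matching on it exposes the letters one by one, without equations
-- about `map` and `upTo`.
data OccursAt {A : Set} (x : InfWord A) : ℕ → List A → Set where
  []  : ∀ {i} → OccursAt x i []
  _∷_ : ∀ {i a u} → x i ≡ a → OccursAt x (suc i) u → OccursAt x i (a ∷ u)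

module _ {A : Set} {x : InfWord A} where

  -- The function `h` is generalised because the recursive call replaces it by `h ∘ suc`.
  occursAt-applyUpTo : ∀ (h : ℕ → A) i u → (∀ j → h j ≡ x (i + j)) →
    applyUpTo h (length u) ≡ u → OccursAt x i u
  occursAt-applyUpTo h i [] eq p = []
  occursAt-applyUpTo h i (a ∷ u) eq p with ∷-injective p
  ... | h0≡a , p′ =
    trans (trans (cong x (sym (+-identityʳ i))) (sym (eq 0))) h0≡a
    ∷ occursAt-applyUpTo (h ∘ suc) (suc i) u (λ j → trans (eq (suc j)) (cong x (+-suc i j))) p′

  applyUpTo-occursAt : ∀ (h : ℕ → A) {i u} → (∀ j → h j ≡ x (i + j)) →
    OccursAt x i u → applyUpTo h (length u) ≡ u
  applyUpTo-occursAt h eq [] = refl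
  applyUpTo-occursAt h {i} eq (p ∷ ps) = cong₂ _∷_
    (trans (eq 0) (trans (cong x (+-identityʳ i)) p))
    (applyUpTo-occursAt (h ∘ suc) (λ j → trans (eq (suc j)) (cong x (+-suc i j))) ps)

  slice⇒occursAt : ∀ i u → slice x i (length u) ≡ u → OccursAt x i u
  slice⇒occursAt i u p = occursAt-applyUpTo _ i u (λ _ → refl)
    (trans (sym (map-applyUpTo id (λ j → x (i + j)) (length u))) p)

  occursAt⇒slice : ∀ {i u} → OccursAt x i u → slice x i (length u) ≡ u
  occursAt⇒slice {i} {u} o = trans (map-applyUpTo id (λ j → x (i + j)) (length u))
    (applyUpTo-occursAt _ (λ _ → refl) o)

  occursAt-++⁺ : ∀ {i u v} → OccursAt x i u → OccursAt x (length u + i) v → OccursAt x i (u ++ v)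
  occursAt-++⁺ [] o = o
  occursAt-++⁺ {i} {v = v} (_∷_ {u = u} p ps) o =
    p ∷ occursAt-++⁺ ps (subst (λ j → OccursAt x j v) (sym (+-suc (length u) i)) o)

  occursAt-++⁻ˡ : ∀ {i} u {v} → OccursAt x i (u ++ v) → OccursAt x i u
  occursAt-++⁻ˡ [] o = []
  occursAt-++⁻ˡ (a ∷ u) (p ∷ o) = p ∷ occursAt-++⁻ˡ u o

  occursAt-++⁻ʳ : ∀ {i} u {v} → OccursAt x i (u ++ v) → OccursAt x (length u + i) v
  occursAt-++⁻ʳ [] o = o
  occursAt-++⁻ʳ {i} (a ∷ u) {v} (p ∷ o) =
    subst (λ j → OccursAt x j v) (+-suc (length u) i) (occursAt-++⁻ʳ u o)

-- A copy of FactorOf that unification does not unfold.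
data Factor {A : Set} (x : InfWord A) (u : List A) : Set where
  at : ∀ {i} → OccursAt x i u → Factor x u

module _ {A : Set} {x : InfWord A} where

  fromFactorOf : ∀ {u} → FactorOf u x → Factor x u
  fromFactorOf {u} (i , p) = at (slice⇒occursAt i u p)

  toFactorOf : ∀ {u} → Factor x u → FactorOf u x
  toFactorOf (at {i} o) = i , occursAt⇒slice o

  factor-prefix : ∀ u {v} → Factor x (u ++ v) → Factor x u
  factor-prefix u (at o) = at (occursAt-++⁻ˡ u o)

  factor-suffix : ∀ u {v} → Factor x (u ++ v) → Factor x v
  factor-suffix u (at o) = at (occursAt-++⁻ʳ u o)

  factor-infix : ∀ p u q {w} → w ≡ p ++ u ++ q → Factor x w → Factor x u
  factor-infix p u q refl f = factor-prefix u (factor-suffix p f)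

segment : {A : Set} → InfWord A → ℕ → ℕ → List A
segment x i zero    = []
segment x i (suc n) = x i ∷ segment x (suc i) n

length-segment : {A : Set} (x : InfWord A) → ∀ i n → length (segment x i n) ≡ n
length-segment x i zero    = refl
length-segment x i (suc n) = cong suc (length-segment x (suc i) n)

segment-occursAt : {A : Set} (x : InfWord A) → ∀ i n → OccursAt x i (segment x i n)
segment-occursAt x i zero    = []
segment-occursAt x i (suc n) = refl ∷ segment-occursAt x (suc i) n

module _ {A : Set} {x : InfWord A} (rec : Recurrent x) where

  reoccursAt : ∀ {i u} → OccursAt x i u → ∀ N → ∃ λ k → N ≤ k × OccursAt x k u
  reoccursAt {i} {u} o N with rec i (length u) N
  ... | k , N≤k , eq = k , N≤k , slice⇒occursAt k u (trans eq (occursAt⇒slice o))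

  -- Recurrence is applied from the end of the first occurrence on, so the second one does not
  -- overlap it.
  factor-return : ∀ u → Factor x u → ∃ λ z → Factor x (u ++ z ++ u)
  factor-return u (at {i} o) with reoccursAt o (length u + i)
  ... | k , N≤k , o′ = z , at (occursAt-++⁺ o
          (occursAt-++⁺ (segment-occursAt x _ _) (subst (λ j → OccursAt x j u) (sym here-k) o′)))
    where
    gap = k ∸ (length u + i)
    z = segment x (length u + i) gap
    here-k : length z + (length u + i) ≡ k
    here-k = trans (cong (_+ (length u + i)) (length-segment x (length u + i) gap)) (m∸n+n≡m N≤k)

  -- An occurrence at a position at least `c` leaves room for `c` letters on its left.
  factor-margins : ∀ {u} → Factor x u → ∀ c →
    ∃₂ λ p q → length p ≡ c × length q ≡ c × Factor x (p ++ u ++ q)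
  factor-margins {u} (at o) c with reoccursAt o c
  ... | k , c≤k , o′ = p , q , length-segment x _ _ , length-segment x _ _ ,
        at (occursAt-++⁺ (segment-occursAt x (k ∸ c) c)
          (subst (λ j → OccursAt x j (u ++ q)) (sym here-k)
            (occursAt-++⁺ o′ (segment-occursAt x _ _))))
    where
    p = segment x (k ∸ c) c
    q = segment x (length u + k) c
    here-k : length p + (k ∸ c) ≡ k
    here-k = trans (cong (_+ (k ∸ c)) (length-segment x (k ∸ c) c)) (m+[n∸m]≡n c≤k)

-- Avoidance and ⪯

prefix⇒++ : {A : Set} {u w : List A} → Prefix _≡_ u w → ∃ λ q → w ≡ u ++ q
prefix⇒++ []           = _ , refl
prefix⇒++ (refl ∷ pre) with prefix⇒++ pre
... | q , refl = q , refl

infix⇒++ : {A : Set} {u w : List A} → Infix _≡_ u w → ∃₂ λ p q → w ≡ p ++ u ++ q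
infix⇒++ (here pre) = [] , prefix⇒++ pre
infix⇒++ (there {b} inf) with infix⇒++ inf
... | p , q , refl = b ∷ p , q , refl

module _ {A B C : Set} where

  image-image : (g : B → List C) (h : A → List B) → ∀ u →
    image (λ a → image g (h a)) u ≡ image g (image h u)
  image-image g h []      = refl
  image-image g h (a ∷ u) =
    trans (cong (image g (h a) ++_) (image-image g h u)) (sym (concatMap-++ g (h a) (image h u)))

image-nonEmpty : {A B : Set} (g : A → List B) → (∀ a → NonEmpty (g a)) →
  ∀ {u} → NonEmpty u → NonEmpty (image g u)
image-nonEmpty g ne {[]}    u≢[] _ = u≢[] refl
image-nonEmpty g ne {a ∷ u} _ eq with g a in ga
... | [] = ne a ga

-- If `h` witnesses `f ⪯ g` and `k` is an occurrence of `g`, then `image k ∘ h` is an occurrence of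
-- `f`.
avoids-⪯ : ∀ {m n} {A : Set} {x : InfWord A} {f : Formula m} {g : Formula n} →
  f ⪯ g → Avoids x f → Avoids x g
avoids-⪯ {x = x} {f} {g} (h , hne , sub) av k (kne , occ) =
  av (λ v → image k (h v)) ((λ v → image-nonEmpty k kne (hne v)) , All.map (λ {φ} → factor φ) sub)
  where
  locate : ∀ w {g′} → All (λ ψ → FactorOf (image k ψ) x) g′ →
    Any (λ ψ → Infix _≡_ w ψ) g′ → Factor x (image k w)
  locate w (o ∷ os) (here inf) with infix⇒++ inf
  ... | p , q , refl = factor-infix (image k p) (image k w) (image k q)
          (trans (concatMap-++ k p (w ++ q)) (cong (image k p ++_) (concatMap-++ k w q)))
          (fromFactorOf o)
  locate w (o ∷ os) (there any) = locate w os any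

  factor : ∀ φ → Any (λ ψ → Infix _≡_ (image h φ) ψ) g →
    FactorOf (image (λ v → image k (h v)) φ) x
  factor φ any = toFactorOf (subst (Factor x) (sym (image-image k h φ)) (locate _ occ any))

-- Square-freeness

SquareFree : {A : Set} → InfWord A → Set
SquareFree x = ∀ u → NonEmpty u → ¬ Factor x (u ++ u)

substitution : {A : Set} → List A → List A → List A → Fin 3 → List A
substitution a b c zero             = a
substitution a b c (suc zero)       = b
substitution a b c (suc (suc zero)) = c

module _ {A : Set} {x : InfWord A} (av : Avoids x upperF) where

  no-occurrence : ∀ a b c → NonEmpty a → NonEmpty b → NonEmpty c →
    Factor x (a ++ b ++ a) → Factor x (a ++ b ++ c ++ b ++ a) →
    Factor x (a ++ c ++ a) → Factor x (a ++ c ++ b) → Factor x (b ++ c ++ a) → ⊥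
  no-occurrence a b c a≢ b≢ c≢ f₁ f₂ f₃ f₄ f₅ = av (substitution a b c) (nonErasing ,
    toFactorOf (pad₃ a b a f₁) ∷ toFactorOf (pad₅ f₂) ∷ toFactorOf (pad₃ a c a f₃) ∷
    toFactorOf (pad₃ a c b f₄) ∷ toFactorOf (pad₃ b c a f₅) ∷ [])
    where
    nonErasing : NonErasing (substitution a b c)
    nonErasing zero             = a≢
    nonErasing (suc zero)       = b≢
    nonErasing (suc (suc zero)) = c≢

    -- `image` closes every fragment with `++ []`.
    pad₃ : ∀ p q r → Factor x (p ++ q ++ r) → Factor x (p ++ q ++ r ++ [])
    pad₃ p q r rewrite ++-identityʳ r = id
    pad₅ : Factor x (a ++ b ++ c ++ b ++ a) → Factor x (a ++ b ++ c ++ b ++ a ++ [])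
    pad₅ rewrite ++-identityʳ a = id

  -- A square uu returns as w = uuduu, and w returns as wzw; then
  -- A ↦ u, B ↦ udu, C ↦ uzu is an occurrence whose ABCBA is exactly wzw.
  avoids⇒squareFree : Recurrent x → SquareFree x
  avoids⇒squareFree rec u u≢ uu with factor-return rec (u ++ u) uu
  ... | d , uuduu with factor-return rec ((u ++ u) ++ d ++ u ++ u) uuduu
  ... | z , wzw = no-occurrence u (u ++ d ++ u) (u ++ z ++ u)
        -- The images of B and C begin with `u`, so they are non-empty even when `d` or `z` is
        -- empty.
        u≢ (u≢ ∘ ++-conicalˡ u _) (u≢ ∘ ++-conicalˡ u _)
        (part [] (u ++ (u ++ d ++ u) ++ u) (z ++ (u ++ u) ++ d ++ u ++ u)
          (solve 3 (λ u d z → W u d ⊕ z ⊕ W u d ⊜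
            nil ⊕ (u ⊕ (u ⊕ d ⊕ u) ⊕ u) ⊕ (z ⊕ W u d)) refl u d z))
        (part [] _ []
          (solve 3 (λ u d z → W u d ⊕ z ⊕ W u d ⊜
            nil ⊕ (u ⊕ (u ⊕ d ⊕ u) ⊕ (u ⊕ z ⊕ u) ⊕ (u ⊕ d ⊕ u) ⊕ u) ⊕ nil) refl u d z))
        (part (u ++ u ++ d) _ (d ++ u ++ u)
          (solve 3 (λ u d z → W u d ⊕ z ⊕ W u d ⊜
            (u ⊕ u ⊕ d) ⊕ (u ⊕ (u ⊕ z ⊕ u) ⊕ u) ⊕ (d ⊕ u ⊕ u)) refl u d z))
        (part (u ++ u ++ d) _ u
          (solve 3 (λ u d z → W u d ⊕ z ⊕ W u d ⊜
            (u ⊕ u ⊕ d) ⊕ (u ⊕ (u ⊕ z ⊕ u) ⊕ (u ⊕ d ⊕ u)) ⊕ u) refl u d z))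
        (part u _ (d ++ u ++ u)
          (solve 3 (λ u d z → W u d ⊕ z ⊕ W u d ⊜
            u ⊕ ((u ⊕ d ⊕ u) ⊕ (u ⊕ z ⊕ u) ⊕ u) ⊕ (d ⊕ u ⊕ u)) refl u d z))
    where
    open import Algebra.Solver.Monoid (++-monoid A) using (solve; _⊕_; _⊜_; Expr) renaming (id to nil)
    W : ∀ {n} → Expr n → Expr n → Expr n
    W u d = (u ⊕ u) ⊕ d ⊕ u ⊕ u
    part : ∀ p v q → ((u ++ u) ++ d ++ u ++ u) ++ z ++ (u ++ u) ++ d ++ u ++ u ≡ p ++ v ++ q →
      Factor x v
    part p v q eq = factor-infix p v q eq wzw

-- Unavoidable factors of square-free words

prefix-factor : ∀ {A : Set} {x : InfWord A} {u w} → Prefix _≡_ u w → Factor x w → Factor x u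
prefix-factor {u = u} pre f with prefix⇒++ pre
... | q , refl = factor-prefix u f

-- tests for a square prefix of p ++ w whose half is longer than p
startsWithSquare : List (Fin 3) → List (Fin 3) → Bool
startsWithSquare p []      = false
startsWithSquare p (a ∷ w) =
  isYes (prefix? _≟_ (p ++ a ∷ []) w) ∨ startsWithSquare (p ++ a ∷ []) w

startsWithAny : List (List (Fin 3)) → List (Fin 3) → Bool
startsWithAny us w = isYes (any? (λ u → prefix? _≟_ u w) us)

mutual

  -- if true, every extension of w to the left by n letters contains a square or a word of us
  blocked : List (List (Fin 3)) → ℕ → List (Fin 3) → Bool
  blocked us zero    w = false
  blocked us (suc n) w = all (blockedBy us n w) (allFin 3)

  blockedBy : List (List (Fin 3)) → ℕ → List (Fin 3) → Fin 3 → Bool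
  blockedBy us n w a =
    startsWithSquare [] (a ∷ w) ∨ startsWithAny us (a ∷ w) ∨ blocked us n (a ∷ w)

-- A data type, so that `us` can be inferred from the type of a proof.
data Unavoidable (us : List (List (Fin 3))) : Set where
  within : ∀ n → T (blocked us n []) → Unavoidable us

module _ {x : InfWord (Fin 3)} (sqfree : SquareFree x) where

  startsWithSquare-sound : ∀ p w → T (startsWithSquare p w) → ¬ Factor x (p ++ w)
  startsWithSquare-sound p (a ∷ w) t f with Equivalence.to T-∨ t
  ... | inj₂ t′ = startsWithSquare-sound (p ++ a ∷ []) w t′ (subst (Factor x) (sym (++-assoc p _ w)) f)
  ... | inj₁ t′ with prefix⇒++ (toWitness {a? = prefix? _≟_ (p ++ a ∷ []) w} t′)
  ... | q , refl = sqfree (p ++ a ∷ []) (λ eq → case-[] (++-conicalʳ p _ eq))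
        (factor-infix [] ((p ++ a ∷ []) ++ p ++ a ∷ []) q
          (trans (sym (++-assoc p (a ∷ []) ((p ++ a ∷ []) ++ q)))
                 (sym (++-assoc (p ++ a ∷ []) (p ++ a ∷ []) q))) f)
    where
    case-[] : a ∷ [] ≢ []
    case-[] ()

  -- The search is followed along the letters that actually precede `w` in `x`. The position `n + i`
  -- leaves room for the `n` letters still to be read.
  blocked-sound : ∀ us n w {i} → T (blocked us n w) → OccursAt x (n + i) w → Any (Factor x) us
  blocked-sound us (suc n) w {i} t o =
    step (x (n + i)) (All.lookup (all⁺ (blockedBy us n w) (allFin 3) t) (∈-allFin _)) refl
    where
    step : ∀ a → T (blockedBy us n w a) → x (n + i) ≡ a → Any (Factor x) us
    step a b eq with Equivalence.to (T-∨ {startsWithSquare [] (a ∷ w)}) b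
    ... | inj₁ sq = ⊥-elim (startsWithSquare-sound [] (a ∷ w) sq (at (eq ∷ o)))
    ... | inj₂ b′ with Equivalence.to (T-∨ {startsWithAny us (a ∷ w)}) b′
    ...   | inj₁ pre = Any.map (λ p → prefix-factor p (at (eq ∷ o)))
                         (toWitness {a? = any? (λ u → prefix? _≟_ u (a ∷ w)) us} pre)
    ...   | inj₂ rec = blocked-sound us n (a ∷ w) rec (eq ∷ o)

  unavoidable : ∀ {us} → Unavoidable us → Any (Factor x) us
  unavoidable {us} (within n t) = blocked-sound us n [] {0} t []

-- The factors aba of x

pattern ⟨_,_,_⟩ a b c = a ∷ b ∷ c ∷ []

palindromes : Fin 3 → Fin 3 → List (List (Fin 3))
palindromes a b = ⟨ a , b , a ⟩ ∷ ⟨ b , a , b ⟩ ∷ []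

Distinct : Fin 3 → Fin 3 → Fin 3 → Set
Distinct a b c = a ≢ b × a ≢ c × b ≢ c

distinct? : ∀ a b c → Dec (Distinct a b c)
distinct? a b c = ¬? (a ≟ b) ×-dec ¬? (a ≟ c) ×-dec ¬? (b ≟ c)

distinct-swapˡ : ∀ {a b c} → Distinct a b c → Distinct b a c
distinct-swapˡ (a≢b , a≢c , b≢c) = ≢-sym a≢b , b≢c , a≢c

distinct-swapʳ : ∀ {a b c} → Distinct a b c → Distinct a c b
distinct-swapʳ (a≢b , a≢c , b≢c) = a≢c , a≢b , ≢-sym b≢c

-- All 27 triples are checked by evaluation, after which `tt` inhabits the premise.
decide-distinct : ∀ {P : Fin 3 → Fin 3 → Fin 3 → Set} (P? : ∀ a b c → Dec (P a b c)) →
  T (isYes (all? λ a → all? λ b → all? λ c → distinct? a b c →-dec P? a b c)) →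
  ∀ {a b c} → Distinct a b c → P a b c
decide-distinct P? t {a} {b} {c} =
  toWitness {a? = all? λ a → all? λ b → all? λ c → distinct? a b c →-dec P? a b c} t a b c

permutations : List (Fin 3 × Fin 3 × Fin 3)
permutations = (t0 , t1 , t2) ∷ (t0 , t2 , t1) ∷ (t1 , t0 , t2)
             ∷ (t1 , t2 , t0) ∷ (t2 , t0 , t1) ∷ (t2 , t1 , t0) ∷ []

-- abstract, lest with-abstractions unfold the exhaustive searches; each bound is one more than
-- the length of the longest square-free word avoiding the set
abstract

  exhausts : ∀ {a b c} → Distinct a b c → ∀ d → d ≡ a ⊎ d ≡ b ⊎ d ≡ c
  exhausts = decide-distinct (λ a b c → all? λ d → (d ≟ a) ⊎-dec (d ≟ b) ⊎-dec (d ≟ c)) tt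

  distinct⇒∈permutations : ∀ {a b c} → Distinct a b c → (a , b , c) ∈ permutations
  distinct⇒∈permutations = decide-distinct (λ a b c →
    any? (≡-dec _≟_ (≡-dec _≟_ _≟_) (a , b , c)) permutations) tt

  rainbow-unavoidable : ∀ {a b c} → Distinct a b c → Unavoidable (⟨ a , b , c ⟩ ∷ [])
  rainbow-unavoidable = All.lookup
    {P = λ (a , b , c) → Unavoidable (⟨ a , b , c ⟩ ∷ [])}
    (within 30 tt ∷ within 30 tt ∷ within 30 tt ∷ within 30 tt ∷ within 30 tt ∷ within 30 tt ∷ [])
    ∘ distinct⇒∈permutations

  -- Applied to the reversal of a cyclic triangle of arcs, it yields the further arc.
  cycle-unavoidable : ∀ {a b c} → Distinct a b c →
    Unavoidable (⟨ a , b , a ⟩ ∷ ⟨ b , c , b ⟩ ∷ ⟨ c , a , c ⟩ ∷ [])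
  cycle-unavoidable = All.lookup
    {P = λ (a , b , c) → Unavoidable (⟨ a , b , a ⟩ ∷ ⟨ b , c , b ⟩ ∷ ⟨ c , a , c ⟩ ∷ [])}
    (within 10 tt ∷ within 10 tt ∷ within 10 tt ∷ within 10 tt ∷ within 10 tt ∷ within 10 tt ∷ [])
    ∘ distinct⇒∈permutations

  -- In the graph of arcs, no letter is isolated.
  palindromes-unavoidable : ∀ {a b c} → Distinct a b c →
    Unavoidable (palindromes a b ++ palindromes a c)
  palindromes-unavoidable = All.lookup
    {P = λ (a , b , c) → Unavoidable (palindromes a b ++ palindromes a c)}
    (within 16 tt ∷ within 16 tt ∷ within 16 tt ∷ within 16 tt ∷ within 16 tt ∷ within 16 tt ∷ [])
    ∘ distinct⇒∈permutations

module Palindromes {x : InfWord (Fin 3)} (rec : Recurrent x) (av : Avoids x upperF) where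

  sqfree : SquareFree x
  sqfree = avoids⇒squareFree av rec

  rainbow : ∀ {a b c} → Distinct a b c → Factor x ⟨ a , b , c ⟩
  rainbow d with unavoidable sqfree (rainbow-unavoidable d)
  ... | here f = f

  -- On either side of bcb, a letter b would give the square bb, and a letter c the square cbcb or
  -- bcbc.
  extend-palindrome : ∀ {a b c} → Distinct a b c → Factor x ⟨ b , c , b ⟩ →
    Factor x (a ∷ b ∷ c ∷ b ∷ a ∷ [])
  extend-palindrome {a} {b} {c} dist f with factor-margins rec f 1
  ... | d ∷ [] , e ∷ [] , _ , _ , g with exhausts dist d | exhausts dist e
  ... | inj₁ refl        | inj₁ refl        = g
  ... | inj₂ (inj₁ refl) | _                =
        ⊥-elim (sqfree (b ∷ []) (λ ()) (factor-prefix (b ∷ b ∷ []) g))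
  ... | inj₂ (inj₂ refl) | _                =
        ⊥-elim (sqfree (c ∷ b ∷ []) (λ ()) (factor-prefix (c ∷ b ∷ c ∷ b ∷ []) g))
  ... | _                | inj₂ (inj₁ refl) =
        ⊥-elim (sqfree (b ∷ []) (λ ()) (factor-suffix ⟨ d , b , c ⟩ g))
  ... | _                | inj₂ (inj₂ refl) =
        ⊥-elim (sqfree (b ∷ c ∷ []) (λ ()) (factor-suffix (d ∷ []) g))

  -- A ↦ a, B ↦ b, C ↦ c would be an occurrence: abcba comes from bcb, while acb and bca are
  -- unavoidable.
  no-transitive : ∀ {a b c} → Distinct a b c →
    Factor x ⟨ a , b , a ⟩ → Factor x ⟨ a , c , a ⟩ → Factor x ⟨ b , c , b ⟩ → ⊥
  no-transitive {a} {b} {c} d aba aca bcb =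
    no-occurrence av (a ∷ []) (b ∷ []) (c ∷ []) (λ ()) (λ ()) (λ ())
      aba (extend-palindrome d bcb) aca (rainbow (distinct-swapʳ d))
      (rainbow (distinct-swapʳ (distinct-swapˡ d)))

  -- Three of the four orientations of the first two arcs form a transitive triangle with b → c. In
  -- the fourth the triangle is cyclic, and any one of the reversed arcs completes a transitive
  -- triangle.
  no-third : ∀ {a b c} → Distinct a b c →
    Any (Factor x) (palindromes a b) → Any (Factor x) (palindromes a c) → ¬ Factor x ⟨ b , c , b ⟩
  no-third d (here aba)         (here aca)         bcb = no-transitive d aba aca bcb
  no-third d (there (here bab)) (here aca)         bcb = no-transitive (distinct-swapˡ d) bab bcb aca
  no-third d (there (here bab)) (there (here cac)) bcb =
    no-transitive (distinct-swapʳ (distinct-swapˡ d)) bcb bab cac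
  no-third d (here aba) (there (here cac)) bcb
    with unavoidable sqfree (cycle-unavoidable (distinct-swapˡ d))
  ... | here bab                 = no-transitive (distinct-swapʳ (distinct-swapˡ d)) bcb bab cac
  ... | there (here aca)         = no-transitive d aba aca bcb
  ... | there (there (here cbc)) = no-transitive (distinct-swapˡ (distinct-swapʳ d)) cac cbc aba

  NoPalindromes : Fin 3 → Fin 3 → Set
  NoPalindromes b c = ¬ Factor x ⟨ b , c , b ⟩ × ¬ Factor x ⟨ c , b , c ⟩

  no-third-pair : ∀ {a b c} → Distinct a b c →
    Any (Factor x) (palindromes a b) → Any (Factor x) (palindromes a c) → NoPalindromes b c
  no-third-pair d ab ac = no-third d ab ac , no-third (distinct-swapʳ d) ac ab

  swap-palindromes : ∀ {a b} → Any (Factor x) (palindromes a b) → Any (Factor x) (palindromes b a)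
  swap-palindromes (here aba)         = there (here aba)
  swap-palindromes (there (here bab)) = here bab

  one-pair : ∀ {a b c} → Distinct a b c →
    Any (Factor x) (palindromes a b) ⊎ Any (Factor x) (palindromes a c)
  one-pair {a} {b} d = ++⁻ (palindromes a b) (unavoidable sqfree (palindromes-unavoidable d))

  -- The letter outside the first pair found lies in a second, different pair. The two pairs share a
  -- letter, so `no-third-pair` excludes the remaining one.
  missing-pair : NoPalindromes t1 t2 ⊎ NoPalindromes t2 t0 ⊎ NoPalindromes t0 t1
  missing-pair with one-pair {t0} {t1} {t2} ((λ ()) , (λ ()) , (λ ()))
  missing-pair | inj₁ p01 with one-pair {t2} {t0} {t1} ((λ ()) , (λ ()) , (λ ()))
  ... | inj₁ p20 = inj₁ (no-third-pair ((λ ()) , (λ ()) , (λ ())) p01 (swap-palindromes p20))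
  ... | inj₂ p21 = inj₂ (inj₁ (no-third-pair ((λ ()) , (λ ()) , (λ ()))
      (swap-palindromes p21) (swap-palindromes p01)))
  missing-pair | inj₂ p02 with one-pair {t1} {t0} {t2} ((λ ()) , (λ ()) , (λ ()))
  ... | inj₁ p10 = inj₁ (no-third-pair ((λ ()) , (λ ()) , (λ ())) (swap-palindromes p10) p02)
  ... | inj₂ p12 = inj₂ (inj₂ (no-third-pair ((λ ()) , (λ ()) , (λ ()))
      (swap-palindromes p02) (swap-palindromes p12)))

-- Desubstitution

-- the two-letter factors of b5
data Edge : Fin 5 → Fin 5 → Set where
  e01 : Edge l0 l1
  e04 : Edge l0 l4
  e10 : Edge l1 l0
  e12 : Edge l1 l2
  e21 : Edge l2 l1
  e23 : Edge l2 l3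
  e30 : Edge l3 l0
  e34 : Edge l3 l4
  e42 : Edge l4 l2

Path : List (Fin 5) → Set
Path = Linked Edge

-- M2 ∘ μ5^k, with μ5 applied innermost, so that images of concrete letters compute while `k` is a
-- variable.
M2μ^ : ℕ → List (Fin 5) → List (Fin 3)
M2μ^ zero    v = image M2 v
M2μ^ (suc k) v = M2μ^ k (image μ5 v)

M2μ^-++ : ∀ k u v → M2μ^ k (u ++ v) ≡ M2μ^ k u ++ M2μ^ k v
M2μ^-++ zero    u v = concatMap-++ M2 u v
M2μ^-++ (suc k) u v = trans (cong (M2μ^ k) (concatMap-++ μ5 u v)) (M2μ^-++ k (image μ5 u) (image μ5 v))

length-image≤ : {A B : Set} (h : A → List B) → ∀ n → (∀ a → length (h a) ≤ n) →
  ∀ u → length (image h u) ≤ length u * n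
length-image≤ h n le []      = z≤n
length-image≤ h n le (a ∷ u) =
  ≤-trans (≤-reflexive (length-++ (h a))) (+-mono-≤ (le a) (length-image≤ h n le u))

-- Each of the `k + 1` morphisms at most doubles the length.
length-M2μ^ : ∀ k v → length (M2μ^ k v) ≤ length v * 2 ^ suc k
length-M2μ^ zero = length-image≤ M2 2 λ where
  zero                         → s≤s (s≤s z≤n)
  (suc zero)                   → s≤s z≤n
  (suc (suc zero))             → s≤s z≤n
  (suc (suc (suc zero)))       → s≤s (s≤s z≤n)
  (suc (suc (suc (suc zero)))) → z≤n
length-M2μ^ (suc k) v = ≤-trans (length-M2μ^ k (image μ5 v))
  (≤-trans (*-monoˡ-≤ (2 ^ suc k) (length-image≤ μ5 2 length-μ5 v))
           (≤-reflexive (*-assoc (length v) 2 (2 ^ suc k))))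
  where
  length-μ5 : ∀ a → length (μ5 a) ≤ 2
  length-μ5 zero                         = s≤s (s≤s z≤n)
  length-μ5 (suc zero)                   = s≤s (s≤s z≤n)
  length-μ5 (suc (suc zero))             = s≤s z≤n
  length-μ5 (suc (suc (suc zero)))       = s≤s (s≤s z≤n)
  length-μ5 (suc (suc (suc (suc zero)))) = s≤s z≤n

M2μ^-nonEmpty₀ : ∀ k v → NonEmpty (M2μ^ k (l0 ∷ v))
M2μ^-nonEmpty₀ zero    v ()
M2μ^-nonEmpty₀ (suc k) v = M2μ^-nonEmpty₀ k (l1 ∷ image μ5 v)

M2μ^-nonEmpty-++ : ∀ k u v → NonEmpty (M2μ^ k v) → NonEmpty (M2μ^ k (u ++ v))
M2μ^-nonEmpty-++ k u v ne eq = ne (++-conicalʳ (M2μ^ k u) _ (trans (sym (M2μ^-++ k u v)) eq))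

mutual

  -- M2 erases 4, so non-emptiness needs an argument: μ5 sends 1 to 23 and 3 to 21, and M2 erases
  -- neither 1 nor 3.
  M2μ^-nonEmpty₁ : ∀ k v → NonEmpty (M2μ^ k (l1 ∷ v))
  M2μ^-nonEmpty₁ zero    v ()
  M2μ^-nonEmpty₁ (suc k) v = M2μ^-nonEmpty-++ k (l2 ∷ []) _ (M2μ^-nonEmpty₃ k (image μ5 v))

  M2μ^-nonEmpty₃ : ∀ k v → NonEmpty (M2μ^ k (l3 ∷ v))
  M2μ^-nonEmpty₃ zero    v ()
  M2μ^-nonEmpty₃ (suc k) v = M2μ^-nonEmpty-++ k (l2 ∷ []) _ (M2μ^-nonEmpty₁ k (image μ5 v))

-- The state of a parser: `a` is the letter whose block was read last and `r` is the rest of the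
-- word. The last few letters may fail to determine a block and are left in `t`.
record Continuation {B : Set} (h : Fin 5 → List B) (a : Fin 5) (r : List B) : Set where
  constructor continuation
  field
    v     : List (Fin 5)
    t     : List B
    path  : Path (a ∷ v)
    split : r ≡ image h v ++ t
    short : length t ≤ 3

module _ {B : Set} {h : Fin 5 → List B} where

  stop : ∀ {a} t → length t ≤ 3 → Continuation h a t
  stop t short = continuation [] t [-] refl short

  emit : ∀ {a b r} → Edge a b → Continuation h b r → Continuation h a (h b ++ r)
  emit {b = b} e (continuation v t path refl short) =
    continuation (b ∷ v) t (e ∷ path) (sym (++-assoc (h b) _ t)) short

record Desubstituted {B : Set} (h : Fin 5 → List B) (w : List B) : Set where
  constructor desubstituted
  field
    s      : List B
    v      : List (Fin 5)
    t      : List B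
    path   : Path v
    split  : w ≡ s ++ image h v ++ t
    shortˡ : length s ≤ 3
    shortʳ : length t ≤ 3

module _ {B : Set} {h : Fin 5 → List B} where

  resume : ∀ s b {r} → length s ≤ 3 → Continuation h b r → Desubstituted h (s ++ h b ++ r)
  resume s b shortˡ (continuation v t path refl short) =
    desubstituted s (b ∷ v) t path (cong (s ++_) (sym (++-assoc (h b) _ t))) shortˡ short

  remainder : ∀ s → length s ≤ 3 → Desubstituted h s
  remainder s short = desubstituted s [] [] [] (sym (++-identityʳ s)) short z≤n

pattern #0 = zero
pattern #1 = suc zero
pattern #2 = suc (suc zero)

pattern 0≤  = z≤n
pattern 1≤  = s≤s z≤n
pattern 2≤  = s≤s (s≤s z≤n)
pattern 3≤  = s≤s (s≤s (s≤s z≤n))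

module Desubstitute (x : InfWord (Fin 3)) (sqfree : SquareFree x)
  (no121 : ¬ Factor x ⟨ t1 , t2 , t1 ⟩) (no212 : ¬ Factor x ⟨ t2 , t1 , t2 ⟩) where

  private
    F : List (Fin 3) → Set
    F = Factor x

    no-repeat : ∀ a {r} {C : Set} → F (a ∷ a ∷ r) → C
    no-repeat a f = ⊥-elim (sqfree (a ∷ []) (λ ()) (factor-prefix (a ∷ a ∷ []) f))

    tail : ∀ {a r} → F (a ∷ r) → F r
    tail {a} = factor-suffix (a ∷ [])

  -- decodeₐ continues after the block M2 a; for a = 1 and a = 2 that block is
  -- recognised by the letter following it, which is already known.
  mutual

    decode₀ : ∀ r → F (t0 ∷ t2 ∷ r) → Continuation M2 l0 r
    decode₀ []             f = stop [] 0≤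
    decode₀ (#0 ∷ [])      f = stop _ 1≤
    decode₀ (#0 ∷ #0 ∷ r)  f = no-repeat t0 (tail (tail f))
    -- No edge leads from 0 to 2; the path passes through 4, whose image under M2 is empty.
    decode₀ (#0 ∷ #1 ∷ r)  f = emit e04 (emit e42 (decode₂ r (tail (tail f))))
    decode₀ (#0 ∷ #2 ∷ r)  f =
      ⊥-elim (sqfree (t0 ∷ t2 ∷ []) (λ ()) (factor-prefix (t0 ∷ t2 ∷ t0 ∷ t2 ∷ []) f))
    decode₀ (#1 ∷ [])      f = stop _ 1≤
    decode₀ (#1 ∷ #0 ∷ r)  f = emit e01 (decode₁ r (tail (tail f)))
    decode₀ (#1 ∷ #1 ∷ r)  f = no-repeat t1 (tail (tail f))
    decode₀ (#1 ∷ #2 ∷ r)  f = ⊥-elim (no212 (factor-prefix ⟨ t2 , t1 , t2 ⟩ (tail f)))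
    decode₀ (#2 ∷ r)       f = no-repeat t2 (tail f)

    decode₁ : ∀ r → F (t1 ∷ t0 ∷ r) → Continuation M2 l1 (t0 ∷ r)
    decode₁ []       f = stop _ 1≤
    decode₁ (#0 ∷ r) f = no-repeat t0 (tail f)
    decode₁ (#1 ∷ r) f = emit e12 (decode₂ r (tail f))
    decode₁ (#2 ∷ r) f = emit e10 (decode₀ r (tail f))

    decode₂ : ∀ r → F (t0 ∷ t1 ∷ r) → Continuation M2 l2 (t1 ∷ r)
    decode₂ []       f = stop _ 1≤
    decode₂ (#0 ∷ r) f = emit e21 (decode₁ r (tail f))
    decode₂ (#1 ∷ r) f = no-repeat t1 (tail f)
    decode₂ (#2 ∷ r) f = emit e23 (decode₃ r (tail f))

    decode₃ : ∀ r → F (t1 ∷ t2 ∷ r) → Continuation M2 l3 r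
    decode₃ []            f = stop [] 0≤
    decode₃ (#0 ∷ [])     f = stop _ 1≤
    decode₃ (#0 ∷ #0 ∷ r) f = no-repeat t0 (tail (tail f))
    decode₃ (#0 ∷ #1 ∷ r) f = emit e34 (emit e42 (decode₂ r (tail (tail f))))
    decode₃ (#0 ∷ #2 ∷ r) f = emit e30 (decode₀ r (tail (tail f)))
    decode₃ (#1 ∷ r)      f = ⊥-elim (no121 (factor-prefix ⟨ t1 , t2 , t1 ⟩ f))
    decode₃ (#2 ∷ r)      f = no-repeat t2 (tail f)

  -- A letter 0 or 1 forms a block with the next letter if that is 2, and a block alone otherwise. A
  -- leading 2 is the end of a cut block and goes into `s`.
  decode : ∀ w → F w → Desubstituted M2 w
  decode []                 f = remainder [] 0≤
  decode (#0 ∷ [])          f = remainder _ 1≤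
  decode (#0 ∷ #0 ∷ r)      f = no-repeat t0 f
  decode (#0 ∷ #1 ∷ r)      f = resume [] l2 0≤ (decode₂ r f)
  decode (#0 ∷ #2 ∷ r)      f = resume [] l0 0≤ (decode₀ r f)
  decode (#1 ∷ [])          f = remainder _ 1≤
  decode (#1 ∷ #0 ∷ r)      f = resume [] l1 0≤ (decode₁ r f)
  decode (#1 ∷ #1 ∷ r)      f = no-repeat t1 f
  decode (#1 ∷ #2 ∷ r)      f = resume [] l3 0≤ (decode₃ r f)
  decode (#2 ∷ [])          f = remainder _ 1≤
  decode (#2 ∷ #0 ∷ [])     f = remainder _ 2≤
  decode (#2 ∷ #0 ∷ #0 ∷ r) f = no-repeat t0 (tail f)
  decode (#2 ∷ #0 ∷ #1 ∷ r) f = resume (t2 ∷ []) l2 1≤ (decode₂ r (tail f))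
  decode (#2 ∷ #0 ∷ #2 ∷ r) f = resume (t2 ∷ []) l0 1≤ (decode₀ r (tail f))
  decode (#2 ∷ #1 ∷ [])     f = remainder _ 2≤
  decode (#2 ∷ #1 ∷ #0 ∷ r) f = resume (t2 ∷ []) l1 1≤ (decode₁ r (tail f))
  decode (#2 ∷ #1 ∷ #1 ∷ r) f = no-repeat t1 (tail f)
  decode (#2 ∷ #1 ∷ #2 ∷ r) f = resume (t2 ∷ []) l3 1≤ (decode₃ r (tail f))
  decode (#2 ∷ #2 ∷ r)      f = no-repeat t2 f

  M2μ^-prefix : ∀ k u {v} → F (M2μ^ k (u ++ v)) → F (M2μ^ k u)
  M2μ^-prefix k u {v} f = factor-prefix (M2μ^ k u) (subst F (M2μ^-++ k u v) f)

  M2μ^-suffix : ∀ k u {v} → F (M2μ^ k (u ++ v)) → F (M2μ^ k v)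
  M2μ^-suffix k u {v} f = factor-suffix (M2μ^ k u) (subst F (M2μ^-++ k u v) f)

  no-square : ∀ k u {r} → NonEmpty (M2μ^ k u) → ¬ F (M2μ^ k ((u ++ u) ++ r))
  no-square k u ne f =
    sqfree (M2μ^ k u) ne (subst F (M2μ^-++ k u u) (M2μ^-prefix k (u ++ u) f))

  no-0101 : ∀ k {r} → ¬ Factor x (M2μ^ k (l0 ∷ l1 ∷ l0 ∷ l1 ∷ r))
  no-0101 k g = no-square k (l0 ∷ l1 ∷ []) (M2μ^-nonEmpty₀ k _) g

  no-1212 : ∀ k {r} → ¬ Factor x (M2μ^ k (l1 ∷ l2 ∷ l1 ∷ l2 ∷ r))
  no-1212 k g = no-square k (l1 ∷ l2 ∷ []) (M2μ^-nonEmpty₁ k _) g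

  no-2121 : ∀ k {r} → ¬ Factor x (M2μ^ k (l2 ∷ l1 ∷ l2 ∷ l1 ∷ r))
  no-2121 k g = no-square k (l2 ∷ l1 ∷ []) (M2μ^-nonEmpty-++ k (l2 ∷ []) _ (M2μ^-nonEmpty₁ k [])) g

  -- In the next three lemmas the square only appears after applying M2, M2 ∘ μ5
  -- (k = 0, 1) or, uniformly for k ≥ 2, after applying μ5 twice.

  no-1210 : ∀ k {r} → ¬ Factor x (M2μ^ k (l1 ∷ l2 ∷ l1 ∷ l0 ∷ r))
  no-1210 zero f = sqfree (t1 ∷ t0 ∷ []) (λ ()) (factor-prefix (t1 ∷ t0 ∷ t1 ∷ t0 ∷ []) f)
  no-1210 (suc zero) f = sqfree (t0 ∷ t1 ∷ t2 ∷ []) (λ ())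
    (factor-prefix (t0 ∷ t1 ∷ t2 ∷ t0 ∷ t1 ∷ t2 ∷ []) f)
  no-1210 (suc (suc k)) f = no-square k (l4 ∷ l2 ∷ l1 ∷ l0 ∷ [])
    (M2μ^-nonEmpty-++ k (l4 ∷ l2 ∷ l1 ∷ []) _ (M2μ^-nonEmpty₀ k []))
    f

  no-42123 : ∀ k {r} → ¬ Factor x (M2μ^ k (l4 ∷ l2 ∷ l1 ∷ l2 ∷ l3 ∷ r))
  no-42123 zero f = sqfree (t0 ∷ t1 ∷ []) (λ ()) (factor-prefix (t0 ∷ t1 ∷ t0 ∷ t1 ∷ []) f)
  no-42123 (suc zero) f = sqfree (t2 ∷ t0 ∷ t1 ∷ []) (λ ())
    (factor-prefix (t2 ∷ t0 ∷ t1 ∷ t2 ∷ t0 ∷ t1 ∷ []) (tail f))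
  no-42123 (suc (suc k)) f = no-square k (l1 ∷ l0 ∷ l4 ∷ l2 ∷ []) (M2μ^-nonEmpty₁ k _)
    (M2μ^-suffix k (l0 ∷ []) f)

  no-3042 : ∀ k {r} → ¬ Factor x (M2μ^ k (l3 ∷ l0 ∷ l4 ∷ l2 ∷ r))
  no-3042 zero f = sqfree (t2 ∷ t0 ∷ []) (λ ()) (factor-prefix (t2 ∷ t0 ∷ t2 ∷ t0 ∷ []) (tail f))
  no-3042 (suc zero) f = sqfree (t1 ∷ t0 ∷ t2 ∷ []) (λ ())
    (factor-prefix (t1 ∷ t0 ∷ t2 ∷ t1 ∷ t0 ∷ t2 ∷ []) (tail f))
  no-3042 (suc (suc k)) f = no-square k (l2 ∷ l3 ∷ l0 ∷ l1 ∷ [])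
    (M2μ^-nonEmpty-++ k (l2 ∷ []) _ (M2μ^-nonEmpty₃ k _))
    (M2μ^-suffix k (l4 ∷ []) f)

  module _ (k : ℕ) where

    private
      H : List (Fin 5) → Set
      H v = Factor x (M2μ^ k v)

      drop : ∀ u {v} → H (u ++ v) → H v
      drop = M2μ^-suffix k

    mutual

      -- `liftₐ` continues after the block μ5(a). A 0 starts 01 or is the block of 4, and a 2 starts
      -- 23 or 21, as the next letter tells. Successions of blocks that are not edges contain one of
      -- the words excluded above.
      lift₀ : ∀ {r} → Path (l1 ∷ r) → H (l0 ∷ l1 ∷ r) → Continuation μ5 l0 r
      lift₀ [-]                   g = stop [] 0≤
      lift₀ (e10 ∷ [-])           g = stop _ 1≤
      lift₀ (e10 ∷ e01 ∷ p)       g = ⊥-elim (no-0101 k g)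
      lift₀ (e10 ∷ e04 ∷ p)       g = emit e04 (emit e42 (lift₂ p (drop (l0 ∷ l1 ∷ l0 ∷ []) g)))
      lift₀ (e12 ∷ [-])           g = stop _ 1≤
      lift₀ (e12 ∷ e21 ∷ [-])     g = stop _ 2≤
      lift₀ (e12 ∷ e21 ∷ e10 ∷ p) g = ⊥-elim (no-1210 k (drop (l0 ∷ []) g))
      lift₀ (e12 ∷ e21 ∷ e12 ∷ p) g = ⊥-elim (no-1212 k (drop (l0 ∷ []) g))
      lift₀ (e12 ∷ e23 ∷ p)       g = emit e01 (lift₁ p (drop (l0 ∷ l1 ∷ []) g))

      lift₁ : ∀ {r} → Path (l3 ∷ r) → H (l2 ∷ l3 ∷ r) → Continuation μ5 l1 r
      lift₁ [-]                   g = stop [] 0≤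
      lift₁ (e30 ∷ [-])           g = stop _ 1≤
      lift₁ (e30 ∷ e01 ∷ p)       g = emit e10 (lift₀ p (drop (l2 ∷ l3 ∷ []) g))
      lift₁ (e30 ∷ e04 ∷ [-])     g = stop _ 2≤
      lift₁ (e30 ∷ e04 ∷ e42 ∷ p) g = ⊥-elim (no-3042 k (drop (l2 ∷ []) g))
      lift₁ (e34 ∷ p)             g = emit e12 (lift₂ p (drop (l2 ∷ l3 ∷ []) g))

      lift₂ : ∀ {r} → Path (l4 ∷ r) → H (l4 ∷ r) → Continuation μ5 l2 r
      lift₂ [-]             g = stop [] 0≤
      lift₂ (e42 ∷ [-])     g = stop _ 1≤
      lift₂ (e42 ∷ e21 ∷ p) g = emit e23 (lift₃ p g)
      lift₂ (e42 ∷ e23 ∷ p) g = emit e21 (lift₁ p (drop (l4 ∷ []) g))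

      -- The block 21 is entered after the block 4 only; that 4 is kept because `no-42123` needs it.
      lift₃ : ∀ {r} → Path (l1 ∷ r) → H (l4 ∷ l2 ∷ l1 ∷ r) → Continuation μ5 l3 r
      lift₃ [-]                   g = stop [] 0≤
      lift₃ (e10 ∷ [-])           g = stop _ 1≤
      lift₃ (e10 ∷ e01 ∷ p)       g = emit e30 (lift₀ p (drop (l4 ∷ l2 ∷ l1 ∷ []) g))
      lift₃ (e10 ∷ e04 ∷ p)       g = emit e34 (emit e42 (lift₂ p (drop (l4 ∷ l2 ∷ l1 ∷ l0 ∷ []) g)))
      lift₃ (e12 ∷ [-])           g = stop _ 1≤
      lift₃ (e12 ∷ e21 ∷ p)       g = ⊥-elim (no-2121 k (drop (l4 ∷ []) g))
      lift₃ (e12 ∷ e23 ∷ p)       g = ⊥-elim (no-42123 k g)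

    -- Parsing starts at the first 01, 23 or 4; the at most three letters before it become `s`.
    lift : ∀ {v} → Path v → H v → Desubstituted μ5 v
    lift []                          g = remainder [] 0≤
    lift {a ∷ []} [-]                g = remainder _ 1≤
    lift (e01 ∷ p)                   g = resume [] l0 0≤ (lift₀ p g)
    lift (e04 ∷ p)                   g = resume (l0 ∷ []) l2 1≤ (lift₂ p (drop (l0 ∷ []) g))
    lift (e10 ∷ [-])                 g = remainder _ 2≤
    lift (e10 ∷ e01 ∷ p)             g = resume (l1 ∷ []) l0 1≤ (lift₀ p (drop (l1 ∷ []) g))
    lift (e10 ∷ e04 ∷ p)             g = resume (l1 ∷ l0 ∷ []) l2 2≤ (lift₂ p (drop (l1 ∷ l0 ∷ []) g))
    lift (e12 ∷ [-])                 g = remainder _ 2≤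
    lift (e12 ∷ e23 ∷ p)             g = resume (l1 ∷ []) l1 1≤ (lift₁ p (drop (l1 ∷ []) g))
    lift (e12 ∷ e21 ∷ [-])           g = remainder _ 3≤
    lift (e12 ∷ e21 ∷ e10 ∷ p)       g = ⊥-elim (no-1210 k g)
    lift (e12 ∷ e21 ∷ e12 ∷ p)       g = ⊥-elim (no-1212 k g)
    lift (e21 ∷ [-])                 g = remainder _ 2≤
    lift (e21 ∷ e10 ∷ [-])           g = remainder _ 3≤
    lift (e21 ∷ e10 ∷ e01 ∷ p)       g = resume (l2 ∷ l1 ∷ []) l0 2≤ (lift₀ p (drop (l2 ∷ l1 ∷ []) g))
    lift (e21 ∷ e10 ∷ e04 ∷ p)       g = resume (l2 ∷ l1 ∷ l0 ∷ []) l2 3≤ (lift₂ p (drop (l2 ∷ l1 ∷ l0 ∷ []) g))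
    lift (e21 ∷ e12 ∷ [-])           g = remainder _ 3≤
    lift (e21 ∷ e12 ∷ e23 ∷ p)       g = resume (l2 ∷ l1 ∷ []) l1 2≤ (lift₁ p (drop (l2 ∷ l1 ∷ []) g))
    lift (e21 ∷ e12 ∷ e21 ∷ p)       g = ⊥-elim (no-2121 k g)
    lift (e23 ∷ p)                   g = resume [] l1 0≤ (lift₁ p g)
    lift (e30 ∷ [-])                 g = remainder _ 2≤
    lift (e30 ∷ e01 ∷ p)             g = resume (l3 ∷ []) l0 1≤ (lift₀ p (drop (l3 ∷ []) g))
    lift (e30 ∷ e04 ∷ p)             g = resume (l3 ∷ l0 ∷ []) l2 2≤ (lift₂ p (drop (l3 ∷ l0 ∷ []) g))
    lift (e34 ∷ p)                   g = resume (l3 ∷ []) l2 1≤ (lift₂ p (drop (l3 ∷ []) g))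
    lift (e42 ∷ p)                   g = resume [] l2 0≤ (lift₂ (e42 ∷ p) g)

  Covered : ℕ → ℕ → Set
  Covered k c = ∀ w → F w → ∃₂ λ s v → ∃ λ t →
    Path v × w ≡ s ++ M2μ^ k v ++ t × length s ≤ c × length t ≤ c

  covered : ∀ k → ∃ λ c → Covered k c
  covered zero = 3 , λ w f →
    let desubstituted s v t path split shortˡ shortʳ = decode w f
    in s , v , t , path , split , shortˡ , shortʳ
  covered (suc k) with covered k
  -- Each margin grows by the image of at most 3 letters, each of image length at most 2^(k+1).
  ... | c , cov = c + 3 * 2 ^ suc k , refine
    where
    refine : Covered (suc k) (c + 3 * 2 ^ suc k)
    refine w f with cov w f
    ... | s , v , t , path , refl , s≤c , t≤c
      with lift k path (factor-infix s (M2μ^ k v) t refl f)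
    ... | desubstituted s′ v′ t′ path′ refl s′≤3 t′≤3 =
      s ++ M2μ^ k s′ , v′ , M2μ^ k t′ ++ t , path′ , split , bound s s′ s≤c s′≤3 ,
      ≤-trans (≤-reflexive (length-++-comm (M2μ^ k t′) t)) (bound t t′ t≤c t′≤3)
      where
      bound : ∀ s s′ → length s ≤ c → length s′ ≤ 3 → length (s ++ M2μ^ k s′) ≤ c + 3 * 2 ^ suc k
      bound s s′ s≤c s′≤3 = ≤-trans (≤-reflexive (length-++ s))
        (+-mono-≤ s≤c (≤-trans (length-M2μ^ k s′) (*-monoˡ-≤ (2 ^ suc k) s′≤3)))
      open import Algebra.Solver.Monoid (++-monoid (Fin 3)) using (solve; _⊕_; _⊜_)
      open ≡-Reasoning
      split : s ++ M2μ^ k (s′ ++ image μ5 v′ ++ t′) ++ t ≡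
        (s ++ M2μ^ k s′) ++ M2μ^ (suc k) v′ ++ M2μ^ k t′ ++ t
      split = begin
        s ++ M2μ^ k (s′ ++ image μ5 v′ ++ t′) ++ t
          ≡⟨ cong (λ z → s ++ z ++ t) (trans (M2μ^-++ k s′ _)
               (cong (M2μ^ k s′ ++_) (M2μ^-++ k (image μ5 v′) t′))) ⟩
        s ++ (M2μ^ k s′ ++ M2μ^ (suc k) v′ ++ M2μ^ k t′) ++ t
          ≡⟨ solve 5 (λ s a b d t → s ⊕ (a ⊕ b ⊕ d) ⊕ t ⊜ (s ⊕ a) ⊕ b ⊕ d ⊕ t) refl
               s (M2μ^ k s′) (M2μ^ (suc k) v′) (M2μ^ k t′) t ⟩
        (s ++ M2μ^ k s′) ++ M2μ^ (suc k) v′ ++ M2μ^ k t′ ++ t ∎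

-- Finite factors and cutting of words

_≼_ : {A : Set} → List A → List A → Set
u ≼ w = ∃₂ λ p q → w ≡ p ++ u ++ q

≼-trans : {A : Set} {u v w : List A} → u ≼ v → v ≼ w → u ≼ w
≼-trans {A} {u} (p , q , refl) (p′ , q′ , refl) = p′ ++ p , q ++ q′ ,
  solve 5 (λ p′ p u q q′ → p′ ⊕ (p ⊕ u ⊕ q) ⊕ q′ ⊜ (p′ ⊕ p) ⊕ u ⊕ q ⊕ q′) refl p′ p u q q′
  where open import Algebra.Solver.Monoid (++-monoid A) using (solve; _⊕_; _⊜_)

factor-≼ : {A : Set} {x : InfWord A} {u w : List A} → u ≼ w → Factor x w → Factor x u
factor-≼ {u = u} (p , q , eq) = factor-infix p u q eq

-- One half of Levi's lemma; it places a factor behind a left margin.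
++-splitˡ : {A : Set} (s p : List A) {m w : List A} → s ++ m ≡ p ++ w → length s ≤ length p →
  ∃ λ r → p ≡ s ++ r × m ≡ r ++ w
++-splitˡ []      p       eq le = p , refl , eq
++-splitˡ (a ∷ s) (b ∷ p) eq (s≤s le) with ∷-injective eq
... | refl , eq′ with ++-splitˡ s p eq′ le
...   | r , refl , m≡ = r , refl , m≡

++-splitʳ : {A : Set} (m w : List A) {t q : List A} → m ++ t ≡ w ++ q → length t ≤ length q →
  ∃ λ r → m ≡ w ++ r
++-splitʳ m       []      eq le = m , refl
++-splitʳ []      (a ∷ w) {q = q} refl le =
  ⊥-elim (<-irrefl refl (≤-trans (s≤s (≤-trans (m≤n+m (length q) (length w))
    (≤-reflexive (sym (length-++ w))))) le))
++-splitʳ (b ∷ m) (a ∷ w) eq le with ∷-injective eq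
... | refl , eq′ with ++-splitʳ m w eq′ le
...   | r , refl = r , refl

-- Factors of w3

w3-prefix : ℕ → List (Fin 3)
w3-prefix n = M2μ^ n (l0 ∷ [])

-- `iter` applies μ5 outermost and `M2μ^` innermost; powers are moved from one to the other one at a
-- time.
M2μ^-iter : ∀ k j → M2μ^ k (iter j) ≡ image M2 (iter (k + j))
M2μ^-iter zero    j = refl
M2μ^-iter (suc k) j = trans (M2μ^-iter k (suc j)) (cong (image M2 ∘ iter) (+-suc k j))

image-iter : ∀ n → image M2 (iter n) ≡ w3-prefix n
image-iter n = trans (cong (image M2 ∘ iter) (sym (+-identityʳ n))) (sym (M2μ^-iter n 0))

w3-prefix-suc : ∀ n → w3-prefix (suc n) ≡ w3-prefix n ++ M2μ^ n (l1 ∷ [])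
w3-prefix-suc n = M2μ^-++ n (l0 ∷ []) (l1 ∷ [])

w3-prefix-extends : ∀ m n → ∃ λ r → w3-prefix (m + n) ≡ w3-prefix n ++ r
w3-prefix-extends zero    n = [] , sym (++-identityʳ _)
w3-prefix-extends (suc m) n with w3-prefix-extends m n
... | r , eq = r ++ M2μ^ (m + n) (l1 ∷ []) ,
  trans (w3-prefix-suc (m + n)) (trans (cong (_++ M2μ^ (m + n) (l1 ∷ [])) eq)
    (++-assoc (w3-prefix n) r _))

nonEmpty⇒1≤length : {A : Set} {u : List A} → NonEmpty u → 1 ≤ length u
nonEmpty⇒1≤length {u = []}    ne = ⊥-elim (ne refl)
nonEmpty⇒1≤length {u = a ∷ u} ne = s≤s z≤n

-- As μ5(0) = 01, each step appends the non-empty image of 1.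
length-w3-prefix : ∀ n → n < length (w3-prefix n)
length-w3-prefix zero    = s≤s z≤n
length-w3-prefix (suc n) = ≤-trans (≤-reflexive (+-comm 1 (suc n)))
  (≤-trans (+-mono-≤ (length-w3-prefix n) (nonEmpty⇒1≤length (M2μ^-nonEmpty₁ n [])))
    (≤-reflexive (trans (sym (length-++ (w3-prefix n))) (cong length (sym (w3-prefix-suc n))))))

nth-++ : {A : Set} (d : A) (u : List A) {v : List A} → ∀ i → i < length u → nth d (u ++ v) i ≡ nth d u i
nth-++ d (a ∷ u) zero    le       = refl
nth-++ d (a ∷ u) (suc i) (s≤s le) = nth-++ d u i le

-- The prefix that defines `w3 i` and the one of index `n` are compared inside a common longer
-- prefix.
w3≡nth : ∀ n i → i < length (w3-prefix n) → w3 i ≡ nth t0 (w3-prefix n) i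
w3≡nth n i i<len = begin
  nth t0 (image M2 (iter (2 + i))) i
    ≡⟨ cong (λ u → nth t0 u i) (image-iter (2 + i)) ⟩
  nth t0 (w3-prefix (2 + i)) i
    ≡⟨ nth-++ t0 (w3-prefix (2 + i)) i (≤-trans (n≤1+n (suc i)) (<⇒≤ (length-w3-prefix (2 + i)))) ⟨
  nth t0 (w3-prefix (2 + i) ++ proj₁ ext₁) i
    ≡⟨ cong (λ u → nth t0 u i) (proj₂ ext₁) ⟨
  nth t0 (w3-prefix (n + (2 + i))) i
    ≡⟨ cong (λ j → nth t0 (w3-prefix j) i) (+-comm n (2 + i)) ⟩
  nth t0 (w3-prefix ((2 + i) + n)) i
    ≡⟨ cong (λ u → nth t0 u i) (proj₂ ext₂) ⟩
  nth t0 (w3-prefix n ++ proj₁ ext₂) i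
    ≡⟨ nth-++ t0 (w3-prefix n) i i<len ⟩
  nth t0 (w3-prefix n) i ∎
  where
  open ≡-Reasoning
  ext₁ = w3-prefix-extends n (2 + i)
  ext₂ = w3-prefix-extends (2 + i) n

nth⇒occursAt : {A : Set} {x : InfWord A} (d : A) → ∀ j u →
  (∀ i → i < length u → x (i + j) ≡ nth d u i) → OccursAt x j u
nth⇒occursAt d j []      eq = []
nth⇒occursAt {x = x} d j (a ∷ u) eq = eq 0 (s≤s z≤n) ∷
  nth⇒occursAt d (suc j) u (λ i i< → trans (cong x (+-suc i j)) (eq (suc i) (s≤s i<)))

w3-prefix-occurs : ∀ n → OccursAt w3 0 (w3-prefix n)
w3-prefix-occurs n = nth⇒occursAt t0 0 (w3-prefix n)
  (λ i i< → trans (cong w3 (+-identityʳ i)) (w3≡nth n i i<))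

occursAt-prefix : {A : Set} {x : InfWord A} → ∀ {i u w} → OccursAt x i u → OccursAt x i w →
  length u ≤ length w → ∃ λ q → w ≡ u ++ q
occursAt-prefix []          ps          le       = _ , refl
occursAt-prefix (refl ∷ os) (refl ∷ ps) (s≤s le) with occursAt-prefix os ps le
... | q , refl = q , refl

occursAt-≼ : {A : Set} {x : InfWord A} → ∀ i {j u w} → OccursAt x (i + j) u → OccursAt x j w →
  i + length u ≤ length w → u ≼ w
occursAt-≼ zero o ps le = [] , occursAt-prefix o ps le
occursAt-≼ {x = x} (suc i) {j} {u} o (_∷_ {a = a} _ ps) (s≤s le)
  with occursAt-≼ i (subst (λ k → OccursAt x k u) (sym (+-suc i j)) o) ps le
... | p , q , refl = a ∷ p , q , refl

factor-w3⇒≼ : ∀ {u} → Factor w3 u → ∃ λ n → u ≼ w3-prefix n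
factor-w3⇒≼ {u} (at {i} o) = i + length u ,
  occursAt-≼ i (subst (λ k → OccursAt w3 k u) (sym (+-identityʳ i)) o)
    (w3-prefix-occurs (i + length u))
    (<⇒≤ (length-w3-prefix (i + length u)))

≼⇒factor-w3 : ∀ {u} n → u ≼ w3-prefix n → Factor w3 u
≼⇒factor-w3 n u≼ = factor-≼ u≼ (at (w3-prefix-occurs n))

M2μ^-≼ : ∀ k {u v} → u ≼ v → M2μ^ k u ≼ M2μ^ k v
M2μ^-≼ k {u} (p , q , refl) = M2μ^ k p , M2μ^ k q ,
  trans (M2μ^-++ k p (u ++ q)) (cong (M2μ^ k p ++_) (M2μ^-++ k u q))

-- `iter 4` is 01234210423, which has every edge but 30; hence the exponent 5.
edge-≼ : ∀ {a b} → Edge a b → (a ∷ b ∷ []) ≼ iter 5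
edge-≼ e01 = [] , _ , refl
edge-≼ e12 = l0 ∷ [] , _ , refl
edge-≼ e23 = l0 ∷ l1 ∷ [] , _ , refl
edge-≼ e34 = l0 ∷ l1 ∷ l2 ∷ [] , _ , refl
edge-≼ e42 = l0 ∷ l1 ∷ l2 ∷ l3 ∷ [] , _ , refl
edge-≼ e21 = l0 ∷ l1 ∷ l2 ∷ l3 ∷ l4 ∷ [] , _ , refl
edge-≼ e10 = l0 ∷ l1 ∷ l2 ∷ l3 ∷ l4 ∷ l2 ∷ [] , _ , refl
edge-≼ e04 = l0 ∷ l1 ∷ l2 ∷ l3 ∷ l4 ∷ l2 ∷ l1 ∷ [] , _ , refl
edge-≼ e30 = l0 ∷ l1 ∷ l2 ∷ l3 ∷ l4 ∷ l2 ∷ l1 ∷ l0 ∷ l4 ∷ l2 ∷ [] , _ , refl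

M2μ^-edge-factor : ∀ k {a b} → Edge a b → Factor w3 (M2μ^ k (a ∷ b ∷ []))
M2μ^-edge-factor k e = ≼⇒factor-w3 (k + 5)
  (subst (M2μ^ k _ ≼_)
    (trans (M2μ^-iter k 5) (image-iter (k + 5)))
    (M2μ^-≼ k (edge-≼ e)))

-- μ5 ^ 3 maps every letter to a word starting with 0.
w3-prefix-≼-M2μ^ : ∀ n a v → ∃ λ r → M2μ^ (3 + n) (a ∷ v) ≡ w3-prefix n ++ r
w3-prefix-≼-M2μ^ n zero                         v = _ , M2μ^-++ n (l0 ∷ []) _
w3-prefix-≼-M2μ^ n (suc zero)                   v = _ , M2μ^-++ n (l0 ∷ []) _
w3-prefix-≼-M2μ^ n (suc (suc zero))             v = _ , M2μ^-++ n (l0 ∷ []) _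
w3-prefix-≼-M2μ^ n (suc (suc (suc zero)))       v = _ , M2μ^-++ n (l0 ∷ []) _
w3-prefix-≼-M2μ^ n (suc (suc (suc (suc zero)))) v = _ , M2μ^-++ n (l0 ∷ []) _

-- Shows that level `3 + length u` is high enough for `within-edge`.
length-M2μ^-letter : ∀ n a → n ≤ length (M2μ^ (3 + n) (a ∷ []))
length-M2μ^-letter n a with w3-prefix-≼-M2μ^ n a []
... | r , eq = ≤-trans (<⇒≤ (length-w3-prefix n))
  (≤-trans (m≤m+n _ (length r)) (≤-reflexive (trans (sym (length-++ (w3-prefix n))) (cong length (sym eq)))))

successor : ∀ a → ∃ (Edge a)
successor zero                         = _ , e01
successor (suc zero)                   = _ , e10
successor (suc (suc zero))             = _ , e21
successor (suc (suc (suc zero)))       = _ , e30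
successor (suc (suc (suc (suc zero)))) = _ , e42

M2μ^-[] : ∀ k → M2μ^ k [] ≡ []
M2μ^-[] zero    = refl
M2μ^-[] (suc k) = M2μ^-[] k

-- A word no longer than the image of any letter meets the images of at most two
-- consecutive letters.
within-edge : ∀ k u → (∀ a → length u ≤ length (M2μ^ k (a ∷ []))) →
  ∀ v → Path v → ∀ p q → M2μ^ k v ≡ p ++ u ++ q → ∃₂ λ a b → Edge a b × u ≼ M2μ^ k (a ∷ b ∷ [])
within-edge k u le [] _ p q eq
  with ++-conicalˡ u q (++-conicalʳ p _ (trans (sym eq) (M2μ^-[] k)))
-- Here `u` is empty and any edge serves.
... | refl = l0 , l1 , e01 , [] , _ , refl
within-edge k u le (a ∷ []) _ p q eq with successor a
... | b , e = a , b , e , ≼-trans (p , q , eq)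
        ([] , M2μ^ k (b ∷ []) , M2μ^-++ k (a ∷ []) (b ∷ []))
within-edge k u le (a ∷ b ∷ v) (e ∷ path) p q eq
  with length (M2μ^ k (a ∷ [])) ≤? length p
... | yes A≤p with ++-splitˡ (M2μ^ k (a ∷ [])) p (trans (sym (M2μ^-++ k (a ∷ []) (b ∷ v))) eq) A≤p
...   | r , refl , eq′ = within-edge k u le (b ∷ v) path r q eq′
-- Now `u` starts inside the image of `a`; being no longer than the image of `b`, it ends within
-- that of `ab`.
within-edge k u le (a ∷ b ∷ v) (e ∷ path) p q eq | no A≰p
  with ++-splitˡ (p ++ u) (M2μ^ k (a ∷ b ∷ []))
         (trans (++-assoc p u q) (trans (sym eq) (M2μ^-++ k (a ∷ b ∷ []) v)))
         (≤-trans (≤-reflexive (length-++ p)) (≤-trans (+-mono-≤ (<⇒≤ (≰⇒> A≰p)) (le b))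
           (≤-reflexive (trans (sym (length-++ (M2μ^ k (a ∷ []))))
             (cong length (sym (M2μ^-++ k (a ∷ []) (b ∷ []))))))))
...   | r , eq′ , _ = a , b , e , p , r , trans eq′ (++-assoc p u r)

-- Equivalence of a word without 121 and 212 with `w3`

module _ {x : InfWord (Fin 3)} (rec : Recurrent x) (sqfree : SquareFree x)
  (no121 : ¬ Factor x ⟨ t1 , t2 , t1 ⟩) (no212 : ¬ Factor x ⟨ t2 , t1 , t2 ⟩) where

  open Desubstitute x sqfree no121 no212

  -- Margins of length `c` around `u` absorb the leftovers `s` and `t`, so `u` lies in the image of
  -- a path, hence in the image of a single edge.
  factor-x⇒w3 : ∀ u → Factor x u → Factor w3 u
  factor-x⇒w3 u f with covered (3 + length u)
  ... | c , cov with factor-margins rec f c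
  ... | p , q , refl , |q|≡c , g with cov _ g
  ... | s , v , t , path , eq , s≤c , t≤c
    with ++-splitˡ s p (sym eq) s≤c
  ... | r , _ , eq′ with ++-splitʳ (M2μ^ (3 + length u) v) (r ++ u) {t} {q} (trans eq′ (sym (++-assoc r u q)))
                           (≤-trans t≤c (≤-reflexive (sym |q|≡c)))
  ... | r′ , eq″ with within-edge (3 + length u) u (length-M2μ^-letter (length u)) v path r r′
                        (trans eq″ (++-assoc r u r′))
  ... | a , b , e , u≼ = factor-≼ u≼ (M2μ^-edge-factor (3 + length u) e)

  w3-prefix-factor : ∀ n → Factor x (w3-prefix n)
  w3-prefix-factor n with covered (3 + n)
  -- A factor longer than both margins together forces a non-empty path, and the image of its first
  -- letter begins with `w3-prefix n`.
  ... | c , cov with cov (segment x 0 (suc (c + c))) (at (segment-occursAt x 0 _))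
  ... | s , a ∷ v , t , path , eq , s≤c , t≤c with w3-prefix-≼-M2μ^ n a v
  ...   | r , eq′ = factor-prefix (w3-prefix n) (subst (Factor x) eq′
            (factor-infix s _ t eq (at (segment-occursAt x 0 _))))
  w3-prefix-factor n | c , cov | s , [] , t , path , eq , s≤c , t≤c =
    ⊥-elim (<-irrefl refl (≤-trans (≤-reflexive
      (trans (sym (length-segment x 0 (suc (c + c))))
        (trans (cong length (trans eq (cong (λ m → s ++ m ++ t) (M2μ^-[] (3 + n))))) (length-++ s))))
      (+-mono-≤ s≤c t≤c)))

  equivalent-w3 : Equivalent x w3
  equivalent-w3 u = mk⇔ (toFactorOf ∘ factor-x⇒w3 u ∘ fromFactorOf) (toFactorOf ∘ back ∘ fromFactorOf)
    where
    back : Factor w3 u → Factor x u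
    back f with factor-w3⇒≼ f
    ... | n , u≼ = factor-≼ u≼ (w3-prefix-factor n)

-- Renaming letters

module _ {A B : Set} (g : A → B) where

  occursAt-map : ∀ {x : InfWord A} {i u} → OccursAt x i u → OccursAt (mapW g x) i (map g u)
  occursAt-map []       = []
  occursAt-map (p ∷ ps) = cong g p ∷ occursAt-map ps

  factor-map : ∀ {x : InfWord A} {u} → Factor x u → Factor (mapW g x) (map g u)
  factor-map (at o) = at (occursAt-map o)

-- Serves words such as `mapW g⁻¹ (mapW g x)`, which agrees with `x` letter by letter.
factor-cong : {A : Set} {x y : InfWord A} → (∀ i → x i ≡ y i) → ∀ {u} → Factor x u → Factor y u
factor-cong {x = x} {y} eq (at o) = at (occ o)
  where
  occ : ∀ {i u} → OccursAt x i u → OccursAt y i u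
  occ []       = []
  occ (p ∷ ps) = trans (sym (eq _)) p ∷ occ ps

recurrent-map : {A B : Set} (g : A → B) {x : InfWord A} → Recurrent x → Recurrent (mapW g x)
recurrent-map g {x} rec i n N with rec i n N
... | k , N≤k , eq = k , N≤k , trans (map-∘ (upTo n)) (trans (cong (map g) eq) (sym (map-∘ (upTo n))))

module _ {A B : Set} (g : A → B) (g⁻¹ : B → A) (inv : ∀ a → g⁻¹ (g a) ≡ a) where

  factor-unmap : ∀ {x : InfWord A} {u} → Factor (mapW g x) u → Factor x (map g⁻¹ u)
  factor-unmap f = factor-cong (λ i → inv _) (factor-map g⁻¹ f)

  squareFree-map : {x : InfWord A} → SquareFree x → SquareFree (mapW g x)
  squareFree-map {x} sf u u≢ f = sf (map g⁻¹ u) (u≢ ∘ map-[]⁻ u)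
    (subst (Factor x) (map-++ g⁻¹ u u) (factor-unmap f))
    where
    map-[]⁻ : ∀ u → map g⁻¹ u ≡ [] → u ≡ []
    map-[]⁻ [] _ = refl

  equivalent-unmap : (∀ b → g (g⁻¹ b) ≡ b) → {x : InfWord A} {y : InfWord B} →
    Equivalent (mapW g x) y → Equivalent x (mapW g⁻¹ y)
  equivalent-unmap inv′ {x} {y} equiv u =
    mk⇔ (toFactorOf ∘ to ∘ fromFactorOf) (toFactorOf ∘ from ∘ fromFactorOf)
    where
    map-inv : map g⁻¹ (map g u) ≡ u
    map-inv = trans (sym (map-∘ u)) (trans (map-cong inv u) (map-id u))
    to : Factor x u → Factor (mapW g⁻¹ y) u
    to f = subst (Factor (mapW g⁻¹ y)) map-inv (factor-map g⁻¹
      (fromFactorOf (Equivalence.to (equiv (map g u)) (toFactorOf (factor-map g f)))))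
    from : Factor (mapW g⁻¹ y) u → Factor x u
    from f = subst (Factor x) map-inv (factor-unmap (fromFactorOf {x = mapW g x}
      (Equivalence.from (equiv (map g u)) (toFactorOf (factor-cong (inv′ ∘ y) (factor-map g f))))))

σ³ : ∀ a → σ (σ (σ a)) ≡ a
σ³ zero             = refl
σ³ (suc zero)       = refl
σ³ (suc (suc zero)) = refl

-- Renaming `x` by `g` moves its missing pair to {121, 212}; the resulting equivalence is renamed
-- back.
equivalent-renamed-w3 : (g g⁻¹ : Fin 3 → Fin 3) → (∀ a → g⁻¹ (g a) ≡ a) → (∀ a → g (g⁻¹ a) ≡ a) →
  ∀ x → Recurrent x → SquareFree x →
  ¬ Factor x (map g⁻¹ ⟨ t1 , t2 , t1 ⟩) → ¬ Factor x (map g⁻¹ ⟨ t2 , t1 , t2 ⟩) →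
  Equivalent x (mapW g⁻¹ w3)
equivalent-renamed-w3 g g⁻¹ inv inv′ x rec sqfree no121 no212 =
  equivalent-unmap g g⁻¹ inv inv′ {x} {w3} (equivalent-w3 {mapW g x}
    (recurrent-map g {x} rec) (squareFree-map g g⁻¹ inv sqfree)
    (no121 ∘ factor-unmap g g⁻¹ inv) (no212 ∘ factor-unmap g g⁻¹ inv))

theorem9 : (f : Formula 3) → IsFormula f → lowerF ⪯ f → f ⪯ upperF →
    (x : InfWord (Fin 3)) → Recurrent x → Avoids x f →
    Equivalent x w3 ⊎ Equivalent x (mapW σ w3) ⊎ Equivalent x (mapW σ (mapW σ w3))
theorem9 f _ _ f⪯upper x rec av
  with avoids-⪯ {x = x} f⪯upper av
... | av′ with avoids⇒squareFree av′ rec | Palindromes.missing-pair {x} rec av′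
... | sqfree | inj₁ (no121 , no212) = inj₁ (equivalent-w3 {x} rec sqfree no121 no212)
-- σ maps 121 and 212 to 202 and 020, and σ² maps them to 010 and 101.
... | sqfree | inj₂ (inj₁ (no202 , no020)) =
  inj₂ (inj₁ (equivalent-renamed-w3 (σ ∘ σ) σ σ³ σ³ x rec sqfree no202 no020))
... | sqfree | inj₂ (inj₂ (no010 , no101)) =
  inj₂ (inj₂ (equivalent-renamed-w3 σ (σ ∘ σ) σ³ σ³ x rec sqfree no010 no101))
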